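{- Let $G$ be a minimal prime graph complement, and suppose $G$ has a vertex of degree $2$. Then $G$ contains an induced $5$-cycle $S$, and there are three vertices of $S$, exactly two of which are adjacent to each other, such that $G$ is obtained from $S$ by duplicating each of these three vertices some finite (possibly zero) number of times, where duplicating a vertex $v$ means adding a new vertex $w$ adjacent to exactly the neighbors of $v$ (and not to $v$). Equivalently, $G$ is isomorphic to the graph with vertex set $\{A,B\}\cup P\cup Q\cup R$ (disjoint union) with $|P|,|Q|,|R|\ge 1$, in which $A$ is adjacent to every vertex of $P\cup R$, $B$ is adjacent to every vertex of $Q\cup R$, every vertex of $P$ is adjacent to every vertex of $Q$, and there are no other edges. In particular, $G$ is the complement of a reseminant graph.
   Context: All graphs are finite and simple. A graph $G$ is a minimal prime graph complement if $G$ has at least $2$ vertices and: (1) the complement $\overline{G}$ is connected; (2) $G$ is triangle-free; (3) $G$ is $3$-colorable (has a proper vertex coloring with $3$ colors); (4) $G$ is edge-maximal with respect to (2) and (3), i.e. for any two distinct nonadjacent vertices $u,v$ of $G$, the graph obtained by adding the edge $uv$ to $G$ either contains a triangle or is not $3$-colorable. (Its complement is called a minimal prime graph.) A minimal prime graph is reseminant if it is obtained from the $5$-cycle $C_5$ by repeated vertex duplication; in terms of complements, $G$ is the complement of a reseminant graph iff $G$ is obtained from $C_5$ by repeatedly choosing a vertex $v$ and adding a new vertex $w$ adjacent to exactly the neighbors of $v$. -}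

module Defs where

open import Data.Empty using (⊥)
open import Data.Fin.Base using (Fin; toℕ)
open import Data.Fin.Properties using (_≟_; all?)
open import Data.List.Base using (List; []; _∷_; allFin; filter; length)
open import Data.List.Membership.Propositional using (_∈_)
open import Data.Maybe.Base using (Maybe; just; nothing)
open import Data.Nat.Base using (ℕ; suc; _≤_)
open import Data.Nat.DivMod using (_%_)
import Data.Nat.Properties as ℕ
open import Data.Product.Base using (Σ-syntax; ∃-syntax; _×_; _,_)
open import Data.Sum.Base using (_⊎_; inj₁; inj₂; reduce; swap)
open import Function.Base using (id; _∘_)
open import Function.Bundles using (_↔_; _⇔_; Inverse)
open import Function.Definitions using (Injective)
open import Level using (0ℓ)
open import Relation.Binary.Construct.Closure.ReflexiveTransitive using (Star)
open import Relation.Binary.Construct.Closure.Symmetric as SymClosure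
  using (SymClosure; fwd; bwd)
open import Relation.Binary.Core using (Rel)
open import Relation.Binary.Definitions using (Decidable; Irreflexive; Symmetric)
open import Relation.Binary.PropositionalEquality
  using (_≡_; _≢_; refl; sym; trans; ≢-sym)
open import Relation.Nullary.Decidable
  using (yes; no; ¬?; _×-dec_; _⊎-dec_; map′; toWitness)
open import Relation.Nullary.Negation using (¬_)

-- Finiteness is imposed by taking the vertex type to be Fin n where it matters.
record Graph (V : Set) : Set₁ where
  infix 4 _~_ _~?_
  field
    _~_      : Rel V 0ℓ
    ~-sym    : Symmetric _~_
    ~-irrefl : Irreflexive _≡_ _~_
    _~?_     : Decidable _~_

infix 4 _≅_
record _≅_ {V W : Set} (G : Graph V) (H : Graph W) : Set where
  private
    module G = Graph G
    module H = Graph H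
  field
    bijection : V ↔ W
  open Inverse bijection public using (to; from)
  field
    preserves : ∀ u v → u G.~ v ⇔ to u H.~ to v

IsInducedEmbedding : {S V : Set} → Graph S → Graph V → (S → V) → Set
IsInducedEmbedding H G f =
  Injective _≡_ _≡_ f × (∀ i j → i H.~ j ⇔ f i G.~ f j)
  where
    module H = Graph H
    module G = Graph G

complement : ∀ {n} → Graph (Fin n) → Graph (Fin n)
complement G = record
  { _~_      = λ u v → u ≢ v × ¬ (u ~ v)
  ; ~-sym    = λ (u≢v , u≁v) → ≢-sym u≢v , u≁v ∘ ~-sym
  ; ~-irrefl = λ u≡v (u≢v , _) → u≢v u≡v
  ; _~?_     = λ u v → ¬? (u ≟ v) ×-dec ¬? (u ~? v)
  }
  where open Graph G

addEdge : ∀ {n} → Graph (Fin n) → {u v : Fin n} → u ≢ v → Graph (Fin n)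
addEdge G {u} {v} u≢v = record
  { _~_      = λ x y → x ~ y ⊎ (x ≡ u × y ≡ v) ⊎ (x ≡ v × y ≡ u)
  ; ~-sym    = λ where
      (inj₁ x~y)                 → inj₁ (~-sym x~y)
      (inj₂ (inj₁ (x≡u , y≡v))) → inj₂ (inj₂ (y≡v , x≡u))
      (inj₂ (inj₂ (x≡v , y≡u))) → inj₂ (inj₁ (y≡u , x≡v))
  ; ~-irrefl = λ where
      x≡y (inj₁ x~y)                  → ~-irrefl x≡y x~y
      refl (inj₂ (inj₁ (x≡u , x≡v))) → u≢v (trans (sym x≡u) x≡v)
      refl (inj₂ (inj₂ (x≡v , x≡u))) → u≢v (trans (sym x≡u) x≡v)
  ; _~?_     = λ x y →
      (x ~? y) ⊎-dec (x ≟ u ×-dec y ≟ v) ⊎-dec (x ≟ v ×-dec y ≟ u)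
  }
  where open Graph G

Connected : ∀ {V} → Graph V → Set
Connected G = ∀ u v → Star (Graph._~_ G) u v

HasTriangle : ∀ {V} → Graph V → Set
HasTriangle G = ∃[ u ] ∃[ v ] ∃[ w ] (u ~ v × v ~ w × u ~ w)
  where open Graph G

ThreeColorable : ∀ {V} → Graph V → Set
ThreeColorable {V} G = Σ[ c ∈ (V → Fin 3) ] (∀ u v → u ~ v → c u ≢ c v)
  where open Graph G

degree : ∀ {n} → Graph (Fin n) → Fin n → ℕ
degree {n} G v = length (filter (v ~?_) (allFin n))
  where open Graph G

record MinimalPrimeGraphComplement {n} (G : Graph (Fin n)) : Set where
  open Graph G
  field
    atLeastTwoVertices  : 2 ≤ n
    complementConnected : Connected (complement G)
    triangleFree        : ¬ HasTriangle G
    threeColorable      : ThreeColorable G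
    edgeMaximal         : ∀ {u v} (u≢v : u ≢ v) → ¬ (u ~ v) →
                          HasTriangle (addEdge G u≢v) ⊎
                          ¬ ThreeColorable (addEdge G u≢v)

C₅ : Graph (Fin 5)
C₅ = record
  { _~_      = λ i j → Next i j ⊎ Next j i
  ; ~-sym    = swap
  ; ~-irrefl = λ { {i} refl → not-Next i ∘ reduce }
  ; _~?_     = λ i j → next? i j ⊎-dec next? j i
  }
  where
    Next : Rel (Fin 5) 0ℓ
    Next i j = suc (toℕ i) % 5 ≡ toℕ j

    next? : Decidable Next
    next? i j = suc (toℕ i) % 5 ℕ.≟ toℕ j

    not-Next : ∀ i → ¬ Next i i
    not-Next = toWitness {a? = all? λ i → ¬? (next? i i)} _

-- The new vertex is nothing; just embeds the original graph.
duplicate : ∀ {V} → Graph V → V → Graph (Maybe V)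
duplicate {V} G v = record
  { _~_      = Adj
  ; ~-sym    = λ {x} {y} → adj-sym x y
  ; ~-irrefl = λ { {x} refl → adj-irrefl x }
  ; _~?_     = adj?
  }
  where
    open Graph G

    Adj : Rel (Maybe V) 0ℓ
    Adj (just x) (just y) = x ~ y
    Adj (just x) nothing  = x ~ v
    Adj nothing  (just y) = v ~ y
    Adj nothing  nothing  = ⊥

    adj-sym : ∀ x y → Adj x y → Adj y x
    adj-sym (just _) (just _) = ~-sym
    adj-sym (just _) nothing  = ~-sym
    adj-sym nothing  (just _) = ~-sym
    adj-sym nothing  nothing  = id

    adj-irrefl : ∀ x → ¬ Adj x x
    adj-irrefl (just _) = ~-irrefl refl
    adj-irrefl nothing  = id

    adj? : Decidable Adj
    adj? (just x) (just y) = x ~? y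
    adj? (just x) nothing  = x ~? v
    adj? nothing  (just y) = v ~? y
    adj? nothing  nothing  = no id

-- DuplicationOf S T G ι : G arises, up to isomorphism, from S by repeatedly
-- duplicating vertices of S that belong to T; ι is the resulting inclusion of
-- S in G.
data DuplicationOf {X : Set} (S : Graph X) (T : List X) :
       {V : Set} → Graph V → (X → V) → Set₁ where
  start   : DuplicationOf S T S id
  dup     : ∀ {V} {G : Graph V} {ι : X → V} →
            DuplicationOf S T G ι → ∀ {t} → t ∈ T →
            DuplicationOf S T (duplicate G (ι t)) (just ∘ ι)
  relabel : ∀ {V W} {G : Graph V} {H : Graph W} {ι : X → V} {κ : X → W} →
            DuplicationOf S T G ι → (φ : G ≅ H) →
            (∀ x → _≅_.to φ (ι x) ≡ κ x) →
            DuplicationOf S T H κ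

-- Here, unlike in DuplicationOf, any vertex of the current graph, including a
-- previously added copy, may be duplicated.
data ComplementOfReseminant : {V : Set} → Graph V → Set₁ where
  pentagon : ComplementOfReseminant C₅
  dup      : ∀ {V} {G : Graph V} → ComplementOfReseminant G → (v : V) →
             ComplementOfReseminant (duplicate G v)
  relabel  : ∀ {V W} {G : Graph V} {H : Graph W} →
             ComplementOfReseminant G → G ≅ H → ComplementOfReseminant H

ExactlyTwoAdjacent : ∀ {V} → Graph V → V → V → V → Set
ExactlyTwoAdjacent G x y z =
  x ≢ y × x ≢ z × y ≢ z × x ~ y × ¬ (x ~ z) × ¬ (y ~ z)
  where open Graph G

data BlowUpVertex (p q r : ℕ) : Set where
  A B : BlowUpVertex p q r
  P   : Fin p → BlowUpVertex p q r
  Q   : Fin q → BlowUpVertex p q r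
  R   : Fin r → BlowUpVertex p q r

data BlowUpEdge {p q r : ℕ} : Rel (BlowUpVertex p q r) 0ℓ where
  A-P : ∀ {i}   → BlowUpEdge A (P i)
  A-R : ∀ {k}   → BlowUpEdge A (R k)
  B-Q : ∀ {j}   → BlowUpEdge B (Q j)
  B-R : ∀ {k}   → BlowUpEdge B (R k)
  P-Q : ∀ {i j} → BlowUpEdge (P i) (Q j)

blowUp : ∀ p q r → Graph (BlowUpVertex p q r)
blowUp p q r = record
  { _~_      = SymClosure BlowUpEdge
  ; ~-sym    = SymClosure.symmetric BlowUpEdge
  ; ~-irrefl = λ { refl (fwd ()) ; refl (bwd ()) }
  ; _~?_     = λ x y → map′
      (λ { (inj₁ e) → fwd e ; (inj₂ e) → bwd e })
      (λ { (fwd e) → inj₁ e ; (bwd e) → inj₂ e })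
      (edge? x y ⊎-dec edge? y x)
  }
  where
    edge? : Decidable (BlowUpEdge {p} {q} {r})
    edge? A     A     = no λ ()
    edge? A     B     = no λ ()
    edge? A     (P _) = yes A-P
    edge? A     (Q _) = no λ ()
    edge? A     (R _) = yes A-R
    edge? B     A     = no λ ()
    edge? B     B     = no λ ()
    edge? B     (P _) = no λ ()
    edge? B     (Q _) = yes B-Q
    edge? B     (R _) = yes B-R
    edge? (P _) A     = no λ ()
    edge? (P _) B     = no λ ()
    edge? (P _) (P _) = no λ ()
    edge? (P _) (Q _) = yes P-Q
    edge? (P _) (R _) = no λ ()
    edge? (Q _) _     = no λ ()
    edge? (R _) _     = no λ ()

{-# OPTIONS --safe #-}

-- Let v be the vertex of degree 2, with neighbours a and b. By maximality, two
-- nonadjacent vertices that some 3-colouring separates have a common neighbour.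
-- Hence a vertex w outside {a, b} ∪ N(a) ∪ N(b) would have the colour of v in
-- every 3-colouring; but the colouring N(a) ↦ 1, N(b) ∖ N(a) ↦ 2, rest ↦ 0
-- separates them. So sorting vertices by their adjacency to a and b defines a
-- homomorphism G → C₅. Maximality makes every homomorphism from G to a
-- triangle-free 3-colourable graph reflect adjacency: two nonadjacent vertices
-- with adjacent images would have a common neighbour, giving a triangle in the
-- image. The homomorphism to C₅ is onto, since otherwise it folds onto an edge
-- and G is complete bipartite, with disconnected complement. So G is a blow-up
-- of C₅ in which the fibres through a and b are singletons.

module Submission where

open import Defs
open import Data.Empty using (⊥-elim)
open import Data.Fin.Base using (Fin; zero; suc; toℕ)
open import Data.Fin.Patterns using (0F; 1F; 2F; 3F; 4F)
open import Data.Fin.Properties using (_≟_; all?; any?; +↔⊎)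
open import Data.List.Base using (List; []; _∷_; allFin; filter; length; lookup)
open import Data.List.Membership.Propositional using (_∈_)
open import Data.List.Membership.Propositional.Properties
  using (∈-allFin; ∈-filter⁺; ∈-filter⁻; ∈-lookup)
import Data.List.Relation.Unary.All as All
open import Data.List.Relation.Unary.AllPairs using (_∷_)
open import Data.List.Relation.Unary.Any using (here; there; index)
open import Data.List.Relation.Unary.Any.Properties using (lookup-index)
open import Data.List.Relation.Unary.Unique.Propositional using (Unique)
open import Data.List.Relation.Unary.Unique.Propositional.Properties
  using (allFin⁺; filter⁺)
open import Data.Maybe.Base using (Maybe; just; nothing)
open import Data.Nat.Base using (ℕ; zero; suc; _+_; _≤_; z≤n; s≤s)
open import Data.Nat.DivMod using (_%_)
open import Data.Product.Base using (Σ-syntax; ∃-syntax; _×_; _,_; proj₁; proj₂; -,_)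
open import Data.Sum.Base using (_⊎_; inj₁; inj₂; [_,_])
open import Data.Sum.Function.Propositional using (_⊎-↔_)
open import Function.Base using (id; _∘_; const)
open import Function.Bundles using (_↔_; _⇔_; Inverse; Equivalence; mk⇔; mk↔ₛ′)
open import Function.Properties.Inverse using (↔-refl; ↔-sym; ↔-trans)
open import Relation.Binary.Construct.Closure.ReflexiveTransitive using (fold)
open import Relation.Binary.Construct.Closure.Symmetric using (fwd; bwd)
open import Relation.Binary.PropositionalEquality
  using (_≡_; _≢_; refl; sym; trans; cong; subst; subst₂; ≢-sym)
open import Relation.Nullary.Decidable
  using (Dec; yes; no; ¬?; _×-dec_; _⊎-dec_; _→-dec_; toWitness; decidable-stable)
open import Relation.Nullary.Negation using (¬_; contradiction)

lookup-injective : ∀ {A : Set} {xs : List A} → Unique xs →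
                   ∀ i j → lookup xs i ≡ lookup xs j → i ≡ j
lookup-injective (_ ∷ _)     zero    zero    _  = refl
lookup-injective (x∉xs ∷ _)  zero    (suc j) eq = contradiction eq (All.lookup x∉xs (∈-lookup j))
lookup-injective (x∉xs ∷ _)  (suc i) zero    eq = contradiction (sym eq) (All.lookup x∉xs (∈-lookup i))
lookup-injective (_ ∷ xs!)   (suc i) (suc j) eq = cong suc (lookup-injective xs! i j eq)

-- Full homomorphisms, pullbacks and duplication.

Hom : ∀ {V W} → Graph V → Graph W → (V → W) → Set
Hom G H h = ∀ u v → u G.~ v → h u H.~ h v
  where
    module G = Graph G
    module H = Graph H

-- Distinct vertices may share an image. Fibres are then independent sets of vertices with equal
-- neighbourhoods, so a full homomorphism onto `H` exhibits `G` as a blow-up of `H`.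
FullHom : ∀ {V W} → Graph V → Graph W → (V → W) → Set
FullHom G H h = ∀ u v → u G.~ v ⇔ h u H.~ h v
  where
    module G = Graph G
    module H = Graph H

pullback : ∀ {V W} → Graph W → (V → W) → Graph V
pullback H h = record
  { _~_      = λ u v → h u ~ h v
  ; ~-sym    = ~-sym
  ; ~-irrefl = λ u≡v → ~-irrefl (cong h u≡v)
  ; _~?_     = λ u v → h u ~? h v
  }
  where open Graph H

pullback-full : ∀ {V W} (H : Graph W) (h : V → W) → FullHom (pullback H h) H h
pullback-full H h u v = mk⇔ id id

-- Both adjacencies are read off in `S`, so a bijection that commutes with the maps to `S` preserves
-- edges without any case analysis.
≅-over : ∀ {V W X} {G : Graph V} {H : Graph W} {S : Graph X} {g : V → X} {h : W → X} →
         FullHom G S g → FullHom H S h →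
         (β : V ↔ W) → (∀ u → h (Inverse.to β u) ≡ g u) → G ≅ H
≅-over {S = S} g-full h-full β hβ≡g = record
  { bijection = β
  ; preserves = λ u v → mk⇔
      (from (h-full _ _) ∘ subst₂ _~_ (sym (hβ≡g u)) (sym (hβ≡g v)) ∘ to (g-full u v))
      (from (g-full u v) ∘ subst₂ _~_ (hβ≡g u) (hβ≡g v) ∘ to (h-full _ _))
  }
  where
    open Graph S
    open Equivalence

-- Induction on `k`: a duplicate of `t` is one more vertex lying over `t`, so each value of `f`
-- costs one `dup`, and `relabel` absorbs the change of vertex type.
pullback-duplication :
  ∀ {X} (S : Graph X) (T : List X) k (f : Fin k → X) → (∀ i → f i ∈ T) →
  DuplicationOf S T (pullback S [ id , f ]) inj₁
pullback-duplication S T zero f f∈T = relabel start φ λ _ → refl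
  where
    φ : S ≅ pullback S [ id , f ]
    φ = record
      { bijection = mk↔ₛ′ inj₁ [ id , (λ ()) ] [ (λ _ → refl) , (λ ()) ] (λ _ → refl)
      ; preserves = λ _ _ → mk⇔ id id
      }
pullback-duplication {X} S T (suc k) f f∈T =
  relabel (dup (pullback-duplication S T k (f ∘ suc) (f∈T ∘ suc)) (f∈T zero)) φ λ _ → refl
  where
    open Graph S
    G = duplicate (pullback S [ id , f ∘ suc ]) (inj₁ (f zero))

    to : Maybe (X ⊎ Fin k) → X ⊎ Fin (suc k)
    -- The newest copy gets index `zero`, because the recursive call has already used `f ∘ suc`.
    to nothing         = inj₂ zero
    to (just (inj₁ x)) = inj₁ x
    to (just (inj₂ i)) = inj₂ (suc i)

    from : X ⊎ Fin (suc k) → Maybe (X ⊎ Fin k)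
    from (inj₁ x)       = just (inj₁ x)
    from (inj₂ zero)    = nothing
    from (inj₂ (suc i)) = just (inj₂ i)

    to∘from : ∀ y → to (from y) ≡ y
    to∘from (inj₁ _)       = refl
    to∘from (inj₂ zero)    = refl
    to∘from (inj₂ (suc _)) = refl

    from∘to : ∀ y → from (to y) ≡ y
    from∘to nothing         = refl
    from∘to (just (inj₁ _)) = refl
    from∘to (just (inj₂ _)) = refl

    to-full : FullHom G (pullback S [ id , f ]) to
    to-full nothing         nothing         = mk⇔ ⊥-elim (~-irrefl refl)
    to-full nothing         (just (inj₁ _)) = mk⇔ id id
    to-full nothing         (just (inj₂ _)) = mk⇔ id id
    to-full (just (inj₁ _)) nothing         = mk⇔ id id
    to-full (just (inj₁ _)) (just (inj₁ _)) = mk⇔ id id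
    to-full (just (inj₁ _)) (just (inj₂ _)) = mk⇔ id id
    to-full (just (inj₂ _)) nothing         = mk⇔ id id
    to-full (just (inj₂ _)) (just (inj₁ _)) = mk⇔ id id
    to-full (just (inj₂ _)) (just (inj₂ _)) = mk⇔ id id

    φ : G ≅ pullback S [ id , f ]
    φ = record { bijection = mk↔ₛ′ to from to∘from from∘to ; preserves = to-full }

duplication⇒reseminant : ∀ {T V} {G : Graph V} {ι : Fin 5 → V} →
                         DuplicationOf C₅ T G ι → ComplementOfReseminant G
duplication⇒reseminant start           = pentagon
duplication⇒reseminant (dup d {t} _)   = dup (duplication⇒reseminant d) _
duplication⇒reseminant (relabel d φ _) = relabel (duplication⇒reseminant d) φ

-- The explicit blow-up as a blow-up of the 5-cycle.

open Graph C₅ using () renaming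
  (_~_ to infix 4 _~₅_; _~?_ to infix 4 _~₅?_; ~-sym to ~₅-sym)

C₅-triangleFree : ¬ HasTriangle C₅
C₅-triangleFree = toWitness
  {a? = ¬? (any? λ u → any? λ v → any? λ w → u ~₅? v ×-dec v ~₅? w ×-dec u ~₅? w)} _

C₅-threeColorable : ThreeColorable C₅
C₅-threeColorable = c , toWitness
  {a? = all? λ u → all? λ v → u ~₅? v →-dec ¬? (c u ≟ c v)} _
  where
    c : Fin 5 → Fin 3
    c 0F = 0F
    c 1F = 1F
    c 2F = 0F
    c 3F = 1F
    c 4F = 2F

-- The classes in cyclic order are A, P, Q, B, R. This fixes the numbering used throughout: 0 and 3
-- are the corners kept single, and 1, 2, 4 are the ones to be duplicated.
corner : ∀ {p q r} → BlowUpVertex p q r → Fin 5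
corner A     = 0F
corner (P _) = 1F
corner (Q _) = 2F
corner B     = 3F
corner (R _) = 4F

corner-full : ∀ {p q r} → FullHom (blowUp p q r) C₅ corner
corner-full {p} {q} {r} x y = mk⇔
    (λ { (fwd e) → edge e ; (bwd e) → ~₅-sym {corner y} {corner x} (edge e) })
    (λ { (inj₁ e) → next x y e ; (inj₂ e) → ~-sym (next y x e) })
  where
    open Graph (blowUp p q r)

    edge : ∀ {x y} → BlowUpEdge x y → corner x ~₅ corner y
    edge A-P = inj₁ refl
    edge A-R = inj₂ refl
    edge B-Q = inj₂ refl
    edge B-R = inj₁ refl
    edge P-Q = inj₁ refl

    next : ∀ x y → suc (toℕ (corner x)) % 5 ≡ toℕ (corner y) → x ~ y
    next A     (P _) _ = fwd A-P
    next (P _) (Q _) _ = fwd P-Q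
    next (Q _) B     _ = bwd B-Q
    next B     (R _) _ = fwd B-R
    next (R _) A     _ = bwd A-R
    next A     A     ()
    next A     B     ()
    next A     (Q _) ()
    next A     (R _) ()
    next (P _) A     ()
    next (P _) B     ()
    next (P _) (P _) ()
    next (P _) (R _) ()
    next (Q _) A     ()
    next (Q _) (P _) ()
    next (Q _) (Q _) ()
    next (Q _) (R _) ()
    next B     A     ()
    next B     B     ()
    next B     (P _) ()
    next B     (Q _) ()
    next (R _) B     ()
    next (R _) (P _) ()
    next (R _) (Q _) ()
    next (R _) (R _) ()

firstAt : ∀ {p q r} → Fin 5 → BlowUpVertex (suc p) (suc q) (suc r)
firstAt 0F = A
firstAt 1F = P zero
firstAt 2F = Q zero
firstAt 3F = B
firstAt 4F = R zero

corner-firstAt : ∀ {p q r} i → corner (firstAt {p} {q} {r} i) ≡ i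
corner-firstAt 0F = refl
corner-firstAt 1F = refl
corner-firstAt 2F = refl
corner-firstAt 3F = refl
corner-firstAt 4F = refl

-- The first element of each class, with `A` and `B`, forms the pentagon. The `p + (q + r)`
-- remaining vertices are copies of corners 1, 2 and 4, so it suffices to match the two vertex sets
-- over `C₅`.
blowUp-duplication : ∀ p q r →
  DuplicationOf C₅ (1F ∷ 2F ∷ 4F ∷ []) (blowUp (suc p) (suc q) (suc r)) firstAt
blowUp-duplication p q r =
  relabel (pullback-duplication C₅ T (p + (q + r)) (extra ∘ split) (extra∈T ∘ split))
    (≅-over {S = C₅} {h = corner} (pullback-full C₅ [ id , extra ∘ split ]) corner-full
      bijection corner∘to)
    λ _ → refl
  where
    T : List (Fin 5)
    T = 1F ∷ 2F ∷ 4F ∷ []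

    Extra : Set
    Extra = Fin p ⊎ Fin q ⊎ Fin r

    extra : Extra → Fin 5
    extra = [ const 1F , [ const 2F , const 4F ] ]

    extra∈T : ∀ e → extra e ∈ T
    extra∈T (inj₁ _)        = here refl
    extra∈T (inj₂ (inj₁ _)) = there (here refl)
    extra∈T (inj₂ (inj₂ _)) = there (there (here refl))

    splitting : Fin (p + (q + r)) ↔ Extra
    splitting = ↔-trans +↔⊎ (↔-refl ⊎-↔ +↔⊎)

    split : Fin (p + (q + r)) → Extra
    split = Inverse.to splitting

    place : Fin 5 ⊎ Extra → BlowUpVertex (suc p) (suc q) (suc r)
    place (inj₁ i)               = firstAt i
    place (inj₂ (inj₁ i))        = P (suc i)
    place (inj₂ (inj₂ (inj₁ j))) = Q (suc j)
    place (inj₂ (inj₂ (inj₂ k))) = R (suc k)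

    unplace : BlowUpVertex (suc p) (suc q) (suc r) → Fin 5 ⊎ Extra
    unplace A           = inj₁ 0F
    unplace B           = inj₁ 3F
    unplace (P zero)    = inj₁ 1F
    unplace (P (suc i)) = inj₂ (inj₁ i)
    unplace (Q zero)    = inj₁ 2F
    unplace (Q (suc j)) = inj₂ (inj₂ (inj₁ j))
    unplace (R zero)    = inj₁ 4F
    unplace (R (suc k)) = inj₂ (inj₂ (inj₂ k))

    place∘unplace : ∀ x → place (unplace x) ≡ x
    place∘unplace A           = refl
    place∘unplace B           = refl
    place∘unplace (P zero)    = refl
    place∘unplace (P (suc _)) = refl
    place∘unplace (Q zero)    = refl
    place∘unplace (Q (suc _)) = refl
    place∘unplace (R zero)    = refl
    place∘unplace (R (suc _)) = refl

    unplace∘place : ∀ y → unplace (place y) ≡ y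
    unplace∘place (inj₁ 0F)              = refl
    unplace∘place (inj₁ 1F)              = refl
    unplace∘place (inj₁ 2F)              = refl
    unplace∘place (inj₁ 3F)              = refl
    unplace∘place (inj₁ 4F)              = refl
    unplace∘place (inj₂ (inj₁ _))        = refl
    unplace∘place (inj₂ (inj₂ (inj₁ _))) = refl
    unplace∘place (inj₂ (inj₂ (inj₂ _))) = refl

    bijection : (Fin 5 ⊎ Fin (p + (q + r))) ↔ BlowUpVertex (suc p) (suc q) (suc r)
    bijection =
      ↔-trans (↔-refl ⊎-↔ splitting) (mk↔ₛ′ place unplace place∘unplace unplace∘place)

    corner-place : ∀ y → corner (place y) ≡ [ id , extra ] y
    corner-place (inj₁ i)               = corner-firstAt {p} {q} {r} i
    corner-place (inj₂ (inj₁ _))        = refl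
    corner-place (inj₂ (inj₂ (inj₁ _))) = refl
    corner-place (inj₂ (inj₂ (inj₂ _))) = refl

    corner∘to : ∀ y → corner (Inverse.to bijection y) ≡ [ id , extra ∘ split ] y
    corner∘to (inj₁ i) = corner-place (inj₁ i)
    corner∘to (inj₂ m) = corner-place (inj₂ (split m))

-- Take `H` itself as the base: the identity and `φ` are full homomorphisms to it, and the inverse
-- bijection commutes with them.
≅-sym : ∀ {V W} {G : Graph V} {H : Graph W} → G ≅ H → H ≅ G
≅-sym {H = H} φ = ≅-over {S = H} {g = id} {h = to} (λ _ _ → mk⇔ id id) preserves
  (↔-sym bijection) strictlyInverseˡ
  where
    open _≅_ φ
    open Inverse bijection using (strictlyInverseˡ)

-- From a full homomorphism to the 5-cycle to the explicit blow-up.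

module _ {n} {G : Graph (Fin n)} (κ : Fin n → Fin 5) (κ-full : FullHom G C₅ κ)
         {a b : Fin n} (κa : κ a ≡ 0F) (κb : κ b ≡ 3F)
         (only-a : ∀ x → κ x ≡ 0F → x ≡ a) (only-b : ∀ x → κ x ≡ 3F → x ≡ b) where

  private
    fibre : Fin 5 → List (Fin n)
    fibre i = filter (λ x → κ x ≟ i) (allFin n)

    size : Fin 5 → ℕ
    size i = length (fibre i)

    ∈-fibre : ∀ x → x ∈ fibre (κ x)
    ∈-fibre x = ∈-filter⁺ (λ y → κ y ≟ κ x) (∈-allFin x) refl

    -- Each fibre is numbered by its position in a duplicate-free list; `rank` and `member`
    -- translate between vertices and positions.
    rank : ∀ x → Fin (size (κ x))
    rank x = index (∈-fibre x)

    member : ∀ i → Fin (size i) → Fin n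
    member i = lookup (fibre i)

    member-rank : ∀ x → member (κ x) (rank x) ≡ x
    member-rank x = sym (lookup-index (∈-fibre x))

    κ-member : ∀ i j → κ (member i j) ≡ i
    κ-member i j = proj₂ (∈-filter⁻ (λ x → κ x ≟ i) {xs = allFin n} (∈-lookup {xs = fibre i} j))

    member-injective : ∀ i {j k} → member i j ≡ member i k → j ≡ k
    member-injective i = lookup-injective (filter⁺ (λ x → κ x ≟ i) (allFin⁺ n)) _ _

    Vertex : Set
    Vertex = BlowUpVertex (size 1F) (size 2F) (size 4F)

    -- Dropping the position at corners 0 and 3 loses nothing, since `only-a` and `only-b` make
    -- those fibres singletons.
    place : ∀ i → Fin (size i) → Vertex
    place 0F _ = A
    place 1F j = P j
    place 2F j = Q j
    place 3F _ = B
    place 4F j = R j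

    to : Fin n → Vertex
    to x = place (κ x) (rank x)

    from : Vertex → Fin n
    from A     = a
    from B     = b
    from (P j) = member 1F j
    from (Q j) = member 2F j
    from (R j) = member 4F j

    corner-place : ∀ i j → corner (place i j) ≡ i
    corner-place 0F _ = refl
    corner-place 1F _ = refl
    corner-place 2F _ = refl
    corner-place 3F _ = refl
    corner-place 4F _ = refl

    from-place : ∀ i j → from (place i j) ≡ member i j
    from-place 0F j = sym (only-a _ (κ-member 0F j))
    from-place 1F _ = refl
    from-place 2F _ = refl
    from-place 3F j = sym (only-b _ (κ-member 3F j))
    from-place 4F _ = refl

    -- `κ (member i j)` equals `i` only propositionally, so the two positions live in different
    -- types. Generalising the corner to `i′` lets the equation be matched.
    place-unique : ∀ {i i′} j j′ → i′ ≡ i → member i′ j′ ≡ member i j → place i′ j′ ≡ place i j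
    place-unique {i} j j′ refl eq = cong (place i) (member-injective i eq)

    to-member : ∀ i j → to (member i j) ≡ place i j
    to-member i j = place-unique j _ (κ-member i j) (member-rank _)

    place-0 : ∀ {i} j → i ≡ 0F → place i j ≡ A
    place-0 _ refl = refl

    place-3 : ∀ {i} j → i ≡ 3F → place i j ≡ B
    place-3 _ refl = refl

    to∘from : ∀ y → to (from y) ≡ y
    to∘from A     = place-0 (rank a) κa
    to∘from B     = place-3 (rank b) κb
    to∘from (P j) = to-member 1F j
    to∘from (Q j) = to-member 2F j
    to∘from (R j) = to-member 4F j

    from∘to : ∀ x → from (to x) ≡ x
    from∘to x = trans (from-place (κ x) (rank x)) (member-rank x)

    -- The rank of `x` inhabits `Fin` of the size, which excludes size zero.
    1≤size : ∀ i → ∃[ x ] κ x ≡ i → 1 ≤ size i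
    1≤size i (x , refl) with size (κ x) | rank x
    ... | suc _ | _ = s≤s z≤n

  fullHom⇒blowUp : ∃[ x ] κ x ≡ 1F → ∃[ x ] κ x ≡ 2F → ∃[ x ] κ x ≡ 4F →
    ∃[ p ] ∃[ q ] ∃[ r ] 1 ≤ p × 1 ≤ q × 1 ≤ r × G ≅ blowUp p q r
  fullHom⇒blowUp x₁ x₂ x₄ =
    size 1F , size 2F , size 4F , 1≤size 1F x₁ , 1≤size 2F x₂ , 1≤size 4F x₄ ,
    ≅-over {S = C₅} {h = corner} κ-full corner-full
      (mk↔ₛ′ to from to∘from from∘to) λ x → corner-place (κ x) (rank x)

-- Triangles through an added edge, and vertices of degree 2.

module _ {n} {G : Graph (Fin n)} where
  open Graph G

  -- If exactly one side is the new edge, the opposite vertex is a common neighbour. Two new sides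
  -- are impossible: both would join `u` and `v`, forcing a loop or `u ≡ v`.
  addEdge-triangle : ∀ {u v} (u≢v : u ≢ v) → HasTriangle (addEdge G u≢v) →
                     HasTriangle G ⊎ ∃[ z ] u ~ z × v ~ z
  addEdge-triangle u≢v (x , y , z , xy , yz , xz) with xy | yz | xz
  ... | inj₁ x~y | inj₁ y~z | inj₁ x~z = inj₁ (x , y , z , x~y , y~z , x~z)
  ... | inj₁ x~y | inj₁ y~z | inj₂ (inj₁ (refl , refl)) = inj₂ (y , x~y , ~-sym y~z)
  ... | inj₁ x~y | inj₁ y~z | inj₂ (inj₂ (refl , refl)) = inj₂ (y , ~-sym y~z , x~y)
  ... | inj₁ x~y | inj₂ (inj₁ (refl , refl)) | inj₁ x~z = inj₂ (x , ~-sym x~y , ~-sym x~z)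
  ... | inj₁ x~y | inj₂ (inj₂ (refl , refl)) | inj₁ x~z = inj₂ (x , ~-sym x~z , ~-sym x~y)
  ... | inj₁ x~y | inj₂ (inj₁ (refl , refl)) | inj₂ (inj₁ (refl , _)) = contradiction x~y (~-irrefl refl)
  ... | inj₁ x~y | inj₂ (inj₁ (refl , refl)) | inj₂ (inj₂ (refl , eq)) = contradiction (sym eq) u≢v
  ... | inj₁ x~y | inj₂ (inj₂ (refl , refl)) | inj₂ (inj₁ (refl , eq)) = contradiction eq u≢v
  ... | inj₁ x~y | inj₂ (inj₂ (refl , refl)) | inj₂ (inj₂ (refl , _)) = contradiction x~y (~-irrefl refl)
  ... | inj₂ (inj₁ (refl , refl)) | inj₁ y~z | inj₁ x~z = inj₂ (z , x~z , y~z)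
  ... | inj₂ (inj₂ (refl , refl)) | inj₁ y~z | inj₁ x~z = inj₂ (z , y~z , x~z)
  ... | inj₂ (inj₁ (refl , refl)) | inj₁ y~z | inj₂ (inj₁ (_ , refl)) = contradiction y~z (~-irrefl refl)
  ... | inj₂ (inj₁ (refl , refl)) | inj₁ y~z | inj₂ (inj₂ (eq , refl)) = contradiction eq u≢v
  ... | inj₂ (inj₂ (refl , refl)) | inj₁ y~z | inj₂ (inj₁ (eq , refl)) = contradiction (sym eq) u≢v
  ... | inj₂ (inj₂ (refl , refl)) | inj₁ y~z | inj₂ (inj₂ (_ , refl)) = contradiction y~z (~-irrefl refl)
  ... | inj₂ (inj₁ (refl , refl)) | inj₂ (inj₁ (eq , refl)) | _ = contradiction (sym eq) u≢v
  ... | inj₂ (inj₁ (refl , refl)) | inj₂ (inj₂ (_ , refl)) | inj₁ x~z = contradiction x~z (~-irrefl refl)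
  ... | inj₂ (inj₁ (refl , refl)) | inj₂ (inj₂ (_ , refl)) | inj₂ (inj₁ (_ , eq)) = contradiction eq u≢v
  ... | inj₂ (inj₁ (refl , refl)) | inj₂ (inj₂ (_ , refl)) | inj₂ (inj₂ (eq , _)) = contradiction eq u≢v
  ... | inj₂ (inj₂ (refl , refl)) | inj₂ (inj₂ (eq , refl)) | _ = contradiction eq u≢v
  ... | inj₂ (inj₂ (refl , refl)) | inj₂ (inj₁ (_ , refl)) | inj₁ x~z = contradiction x~z (~-irrefl refl)
  ... | inj₂ (inj₂ (refl , refl)) | inj₂ (inj₁ (_ , refl)) | inj₂ (inj₁ (eq , _)) = contradiction (sym eq) u≢v
  ... | inj₂ (inj₂ (refl , refl)) | inj₂ (inj₁ (_ , refl)) | inj₂ (inj₂ (_ , eq)) = contradiction (sym eq) u≢v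

  degree-two : ∀ v → degree G v ≡ 2 →
    ∃[ a ] ∃[ b ] a ≢ b × v ~ a × v ~ b × (∀ w → v ~ w → w ≡ a ⊎ w ≡ b)
  degree-two v deg
    -- The neighbour list is abstracted together with its uniqueness, completeness and soundness, so
    -- that matching on its length turns all three into facts about `a ∷ b ∷ []`.
    with filter (v ~?_) (allFin n) | filter⁺ (v ~?_) (allFin⁺ n)
       | (λ w → ∈-filter⁺ (v ~?_) {w} {allFin n} (∈-allFin w))
       | (λ w → ∈-filter⁻ (v ~?_) {w} {allFin n})
  degree-two v refl | a ∷ b ∷ [] | (a≢b All.∷ _) ∷ _ | complete | sound =
    a , b , a≢b , proj₂ (sound a (here refl)) , proj₂ (sound b (there (here refl))) ,
    λ w v~w → ∈-pair (complete w v~w)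
    where
      ∈-pair : ∀ {w} → w ∈ a ∷ b ∷ [] → w ≡ a ⊎ w ≡ b
      ∈-pair (here w≡a)         = inj₁ w≡a
      ∈-pair (there (here w≡b)) = inj₂ w≡b

-- Consequences of edge-maximality.

module _ {n} {G : Graph (Fin n)} (G-mpgc : MinimalPrimeGraphComplement G) where
  open Graph G
  open MinimalPrimeGraphComplement G-mpgc

  -- A colouring that separates `u` and `v` stays proper when the edge is added, so maximality must
  -- fail through a triangle, and that triangle uses the new edge.
  common-neighbour : ∀ {u v} → ¬ (u ~ v) → ((c , _) : ThreeColorable G) → c u ≢ c v →
                     ∃[ z ] u ~ z × v ~ z
  common-neighbour {u} {v} u≁v (c , c-proper) cu≢cv with edgeMaximal (cu≢cv ∘ cong c) u≁v
  ... | inj₁ triangle =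
    [ ⊥-elim ∘ triangleFree , id ] (addEdge-triangle {G = G} (cu≢cv ∘ cong c) triangle)
  ... | inj₂ ¬col     = contradiction (c , proper) ¬col
    where
      proper : ∀ x y → Graph._~_ (addEdge G (cu≢cv ∘ cong c)) x y → c x ≢ c y
      proper x y (inj₁ x~y)                  = c-proper x y x~y
      proper x y (inj₂ (inj₁ (refl , refl))) = cu≢cv
      proper x y (inj₂ (inj₂ (refl , refl))) = ≢-sym cu≢cv

  -- Colouring `G` through `h` separates any two vertices with adjacent images, so
  -- `common-neighbour` applies to them if they are nonadjacent.
  hom⇒full : ∀ {W} (H : Graph W) → ¬ HasTriangle H → ThreeColorable H →
             ∀ {h} → Hom G H h → FullHom G H h
  hom⇒full H H-triangleFree (c , c-proper) {h} h-hom u v =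
    mk⇔ (h-hom u v) λ hu~hv → decidable-stable (u ~? v) λ u≁v →
      let z , u~z , v~z = common-neighbour u≁v
            (c ∘ h , λ x y → c-proper (h x) (h y) ∘ h-hom x y) (c-proper _ _ hu~hv)
      in H-triangleFree (h u , h v , h z , hu~hv , h-hom v z v~z , h-hom u z u~z)

  -- The homomorphism to the 5-cycle given by a vertex of degree 2.

  module _ {v a b} (a≢b : a ≢ b) (v~a : v ~ a) (v~b : v ~ b)
           (v~⇒a⊎b : ∀ w → v ~ w → w ≡ a ⊎ w ≡ b) where

    private
      no-triangle : ∀ {x y z} → x ~ y → z ~ x → ¬ (z ~ y)
      no-triangle x~y z~x z~y = triangleFree (_ , _ , _ , z~x , x~y , z~y)

      a≁b : ¬ (a ~ b)
      a≁b a~b = no-triangle a~b v~a v~b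

      Remote : Fin n → Set
      Remote w = (w ≢ a × w ≢ b) × (¬ (a ~ w) × ¬ (b ~ w))

      -- Otherwise `v` and `w` would have a common neighbour. It would be `a` or `b`, the only
      -- neighbours of `v`, and `w` is adjacent to neither.
      remote-colour : ∀ {w} → Remote w → ((c , _) : ThreeColorable G) → c v ≡ c w
      remote-colour {w} ((w≢a , w≢b) , (a≁w , b≁w)) col@(c , _) =
        decidable-stable (c v ≟ c w) λ cv≢cw →
          let z , v~z , w~z = common-neighbour ([ w≢a , w≢b ] ∘ v~⇒a⊎b w) col cv≢cw
          in [ (λ z≡a → a≁w (subst (_~ w) z≡a (~-sym w~z)))
             , (λ z≡b → b≁w (subst (_~ w) z≡b (~-sym w~z))) ] (v~⇒a⊎b z v~z)

      -- The given 3-colouring is used here only to see that remote vertices share one colour. Their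
      -- independence then makes the new colouring `colour` proper.
      remote-independent : ∀ {w w′} → Remote w → Remote w′ → ¬ (w ~ w′)
      remote-independent rw rw′ w~w′ = proj₂ threeColorable _ _ w~w′
        (trans (sym (remote-colour rw threeColorable)) (remote-colour rw′ threeColorable))

      -- Taking the decisions as arguments makes properness a plain case analysis on them.
      colour : ∀ {x} → Dec (a ~ x) → Dec (b ~ x) → Fin 3
      colour (yes _) _       = 1F
      colour (no _)  (yes _) = 2F
      colour (no _)  (no _)  = 0F

      -- This is colour class 0, which contains `a` and `b` besides remote vertices. If an end of
      -- the edge were `a` or `b`, the other end would be attached; so both ends are remote.
      unattached-independent : ∀ {x y} → ¬ (a ~ x) → ¬ (b ~ x) → ¬ (a ~ y) → ¬ (b ~ y) → ¬ (x ~ y)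
      unattached-independent {x} {y} a≁x b≁x a≁y b≁y x~y =
        remote-independent
          (((λ { refl → a≁y x~y }) , (λ { refl → b≁y x~y })) , (a≁x , b≁x))
          (((λ { refl → a≁x (~-sym x~y) }) , (λ { refl → b≁x (~-sym x~y) })) , (a≁y , b≁y))
          x~y

      colour-proper : ∀ {x y} (ax : Dec (a ~ x)) (bx : Dec (b ~ x))
                      (ay : Dec (a ~ y)) (by : Dec (b ~ y)) →
                      x ~ y → colour ax bx ≢ colour ay by
      colour-proper (yes a~x) _         (yes a~y) _         x~y _ = no-triangle x~y a~x a~y
      colour-proper (no _)    (yes b~x) (no _)    (yes b~y) x~y _ = no-triangle x~y b~x b~y
      colour-proper (no a≁x)  (no b≁x)  (no a≁y)  (no b≁y)  x~y _ =
        unattached-independent a≁x b≁x a≁y b≁y x~y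
      colour-proper (yes _)   _         (no _)    (yes _)   _ ()
      colour-proper (yes _)   _         (no _)    (no _)    _ ()
      colour-proper (no _)    (yes _)   (yes _)   _         _ ()
      colour-proper (no _)    (yes _)   (no _)    (no _)    _ ()
      colour-proper (no _)    (no _)    (yes _)   _         _ ()
      colour-proper (no _)    (no _)    (no _)    (yes _)   _ ()

      colouring : ThreeColorable G
      colouring = (λ x → colour (a ~? x) (b ~? x)) ,
                  λ x y → colour-proper (a ~? x) (b ~? x) (a ~? y) (b ~? y)

      -- `v` is adjacent to `a` and gets colour 1, whereas a remote vertex gets colour 0.
      no-remote : ∀ w → ¬ Remote w
      no-remote w rw@(_ , (a≁w , b≁w)) with a ~? v | a ~? w | b ~? w | remote-colour rw colouring
      ... | no a≁v | _       | _       | _ = a≁v (~-sym v~a)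
      ... | yes _  | yes a~w | _       | _ = a≁w a~w
      ... | yes _  | no _    | yes b~w | _ = b≁w b~w
      ... | yes _  | no _    | no _    | ()

      -- A relation indexed by the corner, so that matching yields the adjacencies to `a` and `b`.
      -- `role` and `role-unique` make it a function.
      data Role (x : Fin n) : Fin 5 → Set where
        is-a : x ≡ a → Role x 0F
        in-P : a ~ x → ¬ (b ~ x) → Role x 1F
        in-Q : ¬ (a ~ x) → b ~ x → Role x 2F
        is-b : x ≡ b → Role x 3F
        in-R : a ~ x → b ~ x → Role x 4F

      role : ∀ x → ∃[ i ] Role x i
      role x with x ≟ a | x ≟ b | a ~? x | b ~? x
      ... | yes x≡a | _       | _       | _       = -, is-a x≡a
      ... | no _    | yes x≡b | _       | _       = -, is-b x≡b
      ... | no _    | no _    | yes a~x | yes b~x = -, in-R a~x b~x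
      ... | no _    | no _    | yes a~x | no b≁x  = -, in-P a~x b≁x
      ... | no _    | no _    | no a≁x  | yes b~x = -, in-Q a≁x b~x
      ... | no x≢a  | no x≢b  | no a≁x  | no b≁x  =
        contradiction ((x≢a , x≢b) , (a≁x , b≁x)) (no-remote x)

      κ : Fin n → Fin 5
      κ x = proj₁ (role x)

      -- There are no loops and `a≁b`, so neither `a` nor `b` lies in either neighbourhood.
      role-unique : ∀ {x i j} → Role x i → Role x j → i ≡ j
      role-unique (is-a refl) (is-a _)       = refl
      role-unique (is-a refl) (in-P a~a _)   = contradiction a~a (~-irrefl refl)
      role-unique (is-a refl) (in-Q _ b~a)   = contradiction (~-sym b~a) a≁b
      role-unique (is-a refl) (is-b a≡b)     = contradiction a≡b a≢b
      role-unique (is-a refl) (in-R a~a _)   = contradiction a~a (~-irrefl refl)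
      role-unique (is-b refl) (is-a b≡a)     = contradiction (sym b≡a) a≢b
      role-unique (is-b refl) (in-P a~b _)   = contradiction a~b a≁b
      role-unique (is-b refl) (in-Q _ b~b)   = contradiction b~b (~-irrefl refl)
      role-unique (is-b refl) (is-b _)       = refl
      role-unique (is-b refl) (in-R a~b _)   = contradiction a~b a≁b
      role-unique (in-P a~x _) (is-a refl)   = contradiction a~x (~-irrefl refl)
      role-unique (in-P _ _) (in-P _ _)      = refl
      role-unique (in-P a~x _) (in-Q a≁x _)  = contradiction a~x a≁x
      role-unique (in-P a~x _) (is-b refl)   = contradiction a~x a≁b
      role-unique (in-P _ b≁x) (in-R _ b~x)  = contradiction b~x b≁x
      role-unique (in-Q _ b~x) (is-a refl)   = contradiction (~-sym b~x) a≁b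
      role-unique (in-Q a≁x _) (in-P a~x _)  = contradiction a~x a≁x
      role-unique (in-Q _ _) (in-Q _ _)      = refl
      role-unique (in-Q _ b~x) (is-b refl)   = contradiction b~x (~-irrefl refl)
      role-unique (in-Q a≁x _) (in-R a~x _)  = contradiction a~x a≁x
      role-unique (in-R a~x _) (is-a refl)   = contradiction a~x (~-irrefl refl)
      role-unique (in-R _ b~x) (in-P _ b≁x)  = contradiction b~x b≁x
      role-unique (in-R a~x _) (in-Q a≁x _)  = contradiction a~x a≁x
      role-unique (in-R a~x _) (is-b refl)   = contradiction a~x a≁b
      role-unique (in-R _ _) (in-R _ _)      = refl

      role⇒κ : ∀ {x i} → Role x i → κ x ≡ i
      role⇒κ = role-unique (proj₂ (role _))

      κ⇒role : ∀ {i} x → κ x ≡ i → Role x i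
      κ⇒role x κx≡i = subst (Role x) κx≡i (proj₂ (role x))

      -- Two vertices attached to the same one of `a` and `b` cannot be adjacent, as that would
      -- close a triangle. Apart from edges at `a` or `b`, only edges between P and Q survive.
      edge-roles : ∀ {x y i j} → Role x i → Role y j → x ~ y → i ~₅ j
      edge-roles (is-a refl)  (is-a refl)  a~a = contradiction a~a (~-irrefl refl)
      edge-roles (is-a refl)  (in-P _ _)   _   = inj₁ refl
      edge-roles (is-a refl)  (in-Q a≁y _) a~y = contradiction a~y a≁y
      edge-roles (is-a refl)  (is-b refl)  a~b = contradiction a~b a≁b
      edge-roles (is-a refl)  (in-R _ _)   _   = inj₂ refl
      edge-roles (is-b refl)  (is-a refl)  b~a = contradiction (~-sym b~a) a≁b
      edge-roles (is-b refl)  (in-P _ b≁y) b~y = contradiction b~y b≁y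
      edge-roles (is-b refl)  (in-Q _ _)   _   = inj₂ refl
      edge-roles (is-b refl)  (is-b refl)  b~b = contradiction b~b (~-irrefl refl)
      edge-roles (is-b refl)  (in-R _ _)   _   = inj₁ refl
      edge-roles (in-P _ _)   (is-a refl)  _   = inj₂ refl
      edge-roles (in-P a~x _) (in-P a~y _) x~y = contradiction a~y (no-triangle x~y a~x)
      edge-roles (in-P _ _)   (in-Q _ _)   _   = inj₁ refl
      edge-roles (in-P _ b≁x) (is-b refl)  x~b = contradiction (~-sym x~b) b≁x
      edge-roles (in-P a~x _) (in-R a~y _) x~y = contradiction a~y (no-triangle x~y a~x)
      edge-roles (in-Q a≁x _) (is-a refl)  x~a = contradiction (~-sym x~a) a≁x
      edge-roles (in-Q _ _)   (in-P _ _)   _   = inj₂ refl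
      edge-roles (in-Q _ b~x) (in-Q _ b~y) x~y = contradiction b~y (no-triangle x~y b~x)
      edge-roles (in-Q _ _)   (is-b refl)  _   = inj₁ refl
      edge-roles (in-Q _ b~x) (in-R _ b~y) x~y = contradiction b~y (no-triangle x~y b~x)
      edge-roles (in-R _ _)   (is-a refl)  _   = inj₁ refl
      edge-roles (in-R a~x _) (in-P a~y _) x~y = contradiction a~y (no-triangle x~y a~x)
      edge-roles (in-R _ b~x) (in-Q _ b~y) x~y = contradiction b~y (no-triangle x~y b~x)
      edge-roles (in-R _ _)   (is-b refl)  _   = inj₂ refl
      edge-roles (in-R a~x _) (in-R a~y _) x~y = contradiction a~y (no-triangle x~y a~x)

      κ-hom : Hom G C₅ κ
      κ-hom x y = edge-roles (proj₂ (role x)) (proj₂ (role y))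

      κ-full : FullHom G C₅ κ
      κ-full = hom⇒full C₅ C₅-triangleFree C₅-threeColorable κ-hom

      -- The only edge collapsed is the one between corners 1 and 2, so the same map folds the path
      -- left by deleting either of them onto the edge between 0 and 1.
      folding : Fin 5 → Fin 5
      folding 0F = 0F
      folding 1F = 1F
      folding 2F = 1F
      folding 3F = 0F
      folding 4F = 1F

      folding-~ : ∀ k → k ≡ 1F ⊎ k ≡ 2F → ∀ i j → i ≢ k → j ≢ k → i ~₅ j → folding i ~₅ folding j
      folding-~ = toWitness {a? = all? λ k → (k ≟ 1F ⊎-dec k ≟ 2F) →-dec all? λ i → all? λ j →
        ¬? (i ≟ k) →-dec ¬? (j ≟ k) →-dec i ~₅? j →-dec folding i ~₅? folding j} _

      folding-≢ : ∀ i j → folding i ≢ folding j → folding i ~₅ folding j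
      folding-≢ = toWitness {a? = all? λ i → all? λ j →
        ¬? (folding i ≟ folding j) →-dec folding i ~₅? folding j} _

      -- Corners 0, 3 and 4 are hit by `a`, `b` and `v`, so only 1 and 2 could be missed.
      κ-hits : ∀ k → k ≡ 1F ⊎ k ≡ 2F → ∃[ x ] κ x ≡ k
      κ-hits k k≡1⊎2 = decidable-stable (any? λ x → κ x ≟ k) λ missed →
        let h-hom x y x~y = folding-~ k k≡1⊎2 (κ x) (κ y)
              (λ κx≡k → missed (x , κx≡k)) (λ κy≡k → missed (y , κy≡k)) (κ-hom x y x~y)
            h-full = hom⇒full C₅ C₅-triangleFree C₅-threeColorable h-hom
            -- Nonadjacent vertices have equal folded images, so the folded map is constant along
            -- paths of the complement; yet `a` folds to 0 and `v`, at corner 4, to 1.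
            step {x} {y} (_ , x≁y) = decidable-stable (folding (κ x) ≟ folding (κ y))
              λ hx≢hy → x≁y (Equivalence.from (h-full x y) (folding-≢ (κ x) (κ y) hx≢hy))
            constant = fold (λ x y → folding (κ x) ≡ folding (κ y))
              (λ {x} {y} x≁y → trans (step {x} {y} x≁y)) refl (complementConnected a v)
        in contradiction
             (trans (cong folding (sym (role⇒κ (is-a refl))))
               (trans constant (cong folding (role⇒κ (in-R (~-sym v~a) (~-sym v~b))))))
             λ ()

    degree-two⇒blowUp : ∃[ p ] ∃[ q ] ∃[ r ] 1 ≤ p × 1 ≤ q × 1 ≤ r × G ≅ blowUp p q r
    degree-two⇒blowUp = fullHom⇒blowUp κ κ-full
      (role⇒κ (is-a refl)) (role⇒κ (is-b refl))
      (λ x κx≡0 → [a] (κ⇒role x κx≡0)) (λ x κx≡3 → [b] (κ⇒role x κx≡3))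
      (κ-hits 1F (inj₁ refl)) (κ-hits 2F (inj₂ refl))
      (v , role⇒κ (in-R (~-sym v~a) (~-sym v~b)))
      where
        [a] : ∀ {x} → Role x 0F → x ≡ a
        [a] (is-a x≡a) = x≡a

        [b] : ∀ {x} → Role x 3F → x ≡ b
        [b] (is-b x≡b) = x≡b

-- The induced pentagon in the graph itself, and the final assembly.

blowUp⇒duplication : ∀ {V} {G : Graph V} {p q r} → 1 ≤ p → 1 ≤ q → 1 ≤ r → G ≅ blowUp p q r →
  Σ[ s ∈ (Fin 5 → V) ]
    IsInducedEmbedding C₅ G s × DuplicationOf C₅ (1F ∷ 2F ∷ 4F ∷ []) G s
blowUp⇒duplication {G = G} {suc p} {suc q} {suc r} (s≤s _) (s≤s _) (s≤s _) φ =
  s , (s-injective , s-full) , relabel (blowUp-duplication p q r) ψ λ _ → refl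
  where
    ψ = ≅-sym φ

    s = _≅_.to ψ ∘ firstAt

    -- Reading off the corner is a left inverse of `s`, which gives injectivity.
    section : ∀ i → corner (_≅_.to φ (s i)) ≡ i
    section i = trans (cong corner (Inverse.strictlyInverseˡ (_≅_.bijection φ) (firstAt i)))
      (corner-firstAt {p} {q} {r} i)

    s-injective : ∀ {i j} → s i ≡ s j → i ≡ j
    s-injective {i} {j} si≡sj =
      trans (sym (section i)) (trans (cong (corner ∘ _≅_.to φ) si≡sj) (section j))

    s-full : FullHom C₅ G s
    s-full i j = mk⇔
      (to (preserves _ _) ∘ from (corner-full (firstAt i) (firstAt j)) ∘
        subst₂ _~₅_ (sym (corner-firstAt {p} {q} {r} i)) (sym (corner-firstAt {p} {q} {r} j)))
      (subst₂ _~₅_ (corner-firstAt {p} {q} {r} i) (corner-firstAt {p} {q} {r} j) ∘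
        to (corner-full (firstAt i) (firstAt j)) ∘ from (preserves _ _))
      where
        open Equivalence
        open _≅_ ψ using (preserves)

theorem2 : ∀ {n : ℕ} (G : Graph (Fin n)) →
    MinimalPrimeGraphComplement G →
    (∃[ v ] degree G v ≡ 2) →
    (Σ[ s ∈ (Fin 5 → Fin n) ]
    IsInducedEmbedding C₅ G s ×
    (∃[ a ] ∃[ b ] ∃[ c ]
    ExactlyTwoAdjacent G (s a) (s b) (s c) ×
    DuplicationOf C₅ (a ∷ b ∷ c ∷ []) G s))
    ×
    (∃[ p ] ∃[ q ] ∃[ r ]
       1 ≤ p × 1 ≤ q × 1 ≤ r × G ≅ blowUp p q r)
    ×
    ComplementOfReseminant G
theorem2 G G-mpgc (v , deg) =
  let a , b , a≢b , v~a , v~b , v~⇒a⊎b = degree-two {G = G} v deg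
      blow@(_ , _ , _ , 1≤p , 1≤q , 1≤r , φ) = degree-two⇒blowUp G-mpgc a≢b v~a v~b v~⇒a⊎b
      s , emb@(s-inj , s-full) , d = blowUp⇒duplication 1≤p 1≤q 1≤r φ
      distinct : ∀ i j → i ≢ j → s i ≢ s j
      distinct i j i≢j = i≢j ∘ s-inj {i} {j}
      nonadjacent : ∀ i j → ¬ (i ~₅ j) → ¬ (Graph._~_ G (s i) (s j))
      nonadjacent i j i≁j = i≁j ∘ Equivalence.from (s-full i j)
  in
  -- The corners of P, Q and R: the first two are consecutive on the cycle, and the third is
  -- consecutive to neither.
  (s , emb , 1F , 2F , 4F ,
    ( distinct 1F 2F (λ ()) , distinct 1F 4F (λ ()) , distinct 2F 4F (λ ())
    , Equivalence.to (s-full 1F 2F) (inj₁ refl)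
    , nonadjacent 1F 4F (λ { (inj₁ ()) ; (inj₂ ()) })
    , nonadjacent 2F 4F (λ { (inj₁ ()) ; (inj₂ ()) })) ,
    d) ,
  blow ,
  duplication⇒reseminant d
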